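{- There are only finitely many $3$-dicritical semi-complete digraphs (up to isomorphism).
   Context: Digraphs are finite, with no loops and no parallel arcs (a pair of opposite arcs $uv,vu$, called a digon, is allowed). A $k$-dicolouring of a digraph $D$ is a map $\phi:V(D)\to\{1,\dots,k\}$ such that each colour class induces an acyclic subdigraph (no directed cycle; a digon counts as a directed cycle of length 2). $D$ is $k$-dicolourable if it has a $k$-dicolouring. $D$ is $3$-dicritical if $D$ is not $2$-dicolourable but every proper subdigraph of $D$ (obtained by deleting at least one vertex or arc) is $2$-dicolourable. A digraph is semi-complete if for every two distinct vertices $u,v$ at least one of the arcs $uv$, $vu$ is present. -}

module Defs where

open import Data.Bool.Base using (Bool; T)
open import Data.Fin.Base using (Fin; zero; suc; inject₁; fromℕ)
open import Data.Fin.Properties using (_≟_)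
open import Data.Nat.Base using (ℕ; suc)
open import Data.Product.Base using (Σ; _×_; _,_; proj₁; proj₂; ∃-syntax)
open import Data.Sum.Base using (_⊎_)
open import Function.Base using (_∘_)
open import Function.Bundles using (_↔_; Inverse)
open import Function.Construct.Composition using (_↔-∘_)
open import Function.Construct.Identity using (↔-id)
open import Function.Construct.Symmetry using (↔-sym)
open import Function.Definitions using (Injective)
open import Level using (0ℓ)
open import Relation.Binary.Bundles using (Setoid)
open import Relation.Binary.PropositionalEquality
  using (_≡_; _≢_; refl; sym; trans; cong₂)
open import Relation.Nullary.Decidable.Core using (⌊_⌋)
open import Relation.Nullary.Negation.Core using (¬_)
import Relation.Binary.Construct.On as On

-- Being Boolean-valued, `arc` admits no parallel arcs; a digon is a pair
-- u, v with arcs both ways.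

record Digraph (V : Set) : Set where
  field
    arc      : V → V → Bool
    loopless : ∀ v → ¬ T (arc v v)

  infix 4 _⟶_
  _⟶_ : V → V → Set
  u ⟶ v = T (arc u v)

-- The cycle visits the suc m distinct vertices `vertex zero`, …,
-- `vertex (fromℕ m)`, in this order.  Looplessness rules out m = 0, and
-- m = 1 is a digon.

record DirectedCycle {V : Set} (D : Digraph V) : Set where
  open Digraph D
  field
    m         : ℕ
    vertex    : Fin (suc m) → V
    injective : Injective _≡_ _≡_ vertex
    step      : ∀ (i : Fin m) → vertex (inject₁ i) ⟶ vertex (suc i)
    close     : vertex (fromℕ m) ⟶ vertex zero

Acyclic : {V : Set} → Digraph V → Set
Acyclic D = ¬ DirectedCycle D

-- A vertex set is given by a Boolean predicate so that its members form a
-- type, Σ V (T ∘ P), on which equality is equality of vertices.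

infix 8 _[_]
_[_] : {V : Set} → Digraph V → (P : V → Bool) → Digraph (Σ V (T ∘ P))
D [ P ] = record
  { arc      = λ u v → arc (proj₁ u) (proj₁ v)
  ; loopless = λ v → loopless (proj₁ v)
  }
  where open Digraph D

IsDicolouring : {V : Set} {k : ℕ} → Digraph V → (V → Fin k) → Set
IsDicolouring {k = k} D φ = ∀ (c : Fin k) → Acyclic (D [ (λ v → ⌊ φ v ≟ c ⌋) ])

Dicolourable : {V : Set} → ℕ → Digraph V → Set
Dicolourable {V} k D = ∃[ φ ] IsDicolouring {V} {k} D φ

record Subdigraph {V : Set} (D : Digraph V) : Set where
  open Digraph D using (_⟶_; loopless)
  field
    hasVertex : V → Bool
    hasArc    : V → V → Bool
    endpoints : ∀ {u v} → T (hasArc u v) → T (hasVertex u) × T (hasVertex v)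
    arc⊆      : ∀ {u v} → T (hasArc u v) → u ⟶ v

  digraph : Digraph (Σ V (T ∘ hasVertex))
  digraph = record
    { arc      = λ u v → hasArc (proj₁ u) (proj₁ v)
    ; loopless = λ v → loopless (proj₁ v) ∘ arc⊆
    }

  Proper : Set
  Proper = (∃[ v ] ¬ T (hasVertex v))
         ⊎ (∃[ u ] ∃[ v ] (u ⟶ v × ¬ T (hasArc u v)))

ThreeDicritical : {V : Set} → Digraph V → Set
ThreeDicritical D =
  ¬ Dicolourable 2 D ×
  (∀ (H : Subdigraph D) → Subdigraph.Proper H →
     Dicolourable 2 (Subdigraph.digraph H))

SemiComplete : {V : Set} → Digraph V → Set
SemiComplete D = ∀ u v → u ≢ v → u ⟶ v ⊎ v ⟶ u
  where open Digraph D

record _≅_ {V W : Set} (D : Digraph V) (E : Digraph W) : Set where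
  field
    bijection : V ↔ W
  open Inverse bijection public using (to; from; strictlyInverseˡ)
  field
    preserves : ∀ u v → Digraph.arc D u v ≡ Digraph.arc E (to u) (to v)

≅-refl : {V : Set} {D : Digraph V} → D ≅ D
≅-refl = record { bijection = ↔-id _ ; preserves = λ _ _ → refl }

≅-sym : {V W : Set} {D : Digraph V} {E : Digraph W} → D ≅ E → E ≅ D
≅-sym {E = E} i = record
  { bijection = ↔-sym bijection
  ; preserves = λ u v → sym (trans (preserves (from u) (from v))
      (cong₂ (Digraph.arc E) (strictlyInverseˡ u) (strictlyInverseˡ v)))
  }
  where open _≅_ i

≅-trans : {U V W : Set} {C : Digraph U} {D : Digraph V} {E : Digraph W} →
          C ≅ D → D ≅ E → C ≅ E
≅-trans i j = record
  { bijection = J.bijection ↔-∘ I.bijection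
  ; preserves = λ u v → trans (I.preserves u v) (J.preserves (I.to u) (I.to v))
  }
  where
  module I = _≅_ i
  module J = _≅_ j

-- Up to isomorphism, the vertex set of a finite digraph is some Fin n.

FiniteDigraph : Set
FiniteDigraph = Σ ℕ λ n → Digraph (Fin n)

isomorphismSetoid : Setoid 0ℓ 0ℓ
isomorphismSetoid = record
  { Carrier       = FiniteDigraph
  ; _≈_           = λ D E → proj₂ D ≅ proj₂ E
  ; isEquivalence = record { refl = ≅-refl ; sym = ≅-sym ; trans = ≅-trans }
  }

threeDicriticalSemiComplete : Setoid 0ℓ 0ℓ
threeDicriticalSemiComplete = On.setoid
  {B = Σ FiniteDigraph λ D → ThreeDicritical (proj₂ D) × SemiComplete (proj₂ D)}
  isomorphismSetoid proj₁

{-# OPTIONS --safe #-}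

-- For an arc u ⟶ v of D take a 2-dicolouring of D minus that arc.  The colour
-- class of u and v acquires a cycle from u ⟶ v, and as D is semi-complete a
-- short one, so the class contains some w with v ⟶ w ⟶ u unless v ⟶ u.  Hence
-- every a with u ⟶ a ⟶ v has the other colour, and there is no directed
-- triangle between u and v.  If D is large, Ramsey's theorem gives a long
-- transitive tournament x₁, z₁, x₂, z₂, …, and each arc xᵢ ⟶ zᵢ lies on a
-- directed triangle xᵢ, zᵢ, yᵢ.  Applying Ramsey's theorem to the arcs between
-- the yᵢ and the zⱼ makes the pattern homogeneous, and each homogeneous pattern
-- has an arc with a triangle between its ends, or one without such a colouring.
-- So the order of D is bounded.

module Submission where

open import Defs
open import Data.Bool.Base using (Bool; true; false; T; if_then_else_)
open import Data.Bool.Properties using (T-irrelevant)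
open import Data.Empty using (⊥)
open import Data.Fin.Base
  using (Fin; zero; suc; inject₁; fromℕ; combine; remQuot; finToFun; funToFin; punchIn)
import Data.Fin.Properties as Fin
open import Data.List.Base
  using (List; []; _∷_; length; filter; reverse; allFin; upTo; concatMap)
open import Data.List.Membership.Propositional using (lose)
open import Data.List.Membership.Propositional.Properties using (∈-allFin; ∈-upTo⁺)
open import Data.List.Properties
  using (unfold-reverse; length-reverse; length-map; length-tabulate)
open import Data.List.Relation.Binary.Sublist.Propositional
  using (_⊆_; []; _∷_; _∷ʳ_; ⊆-trans; minimum)
open import Data.List.Relation.Binary.Sublist.Propositional.Properties
  using (All-resp-⊆; filter-⊆)
open import Data.List.Relation.Unary.All as All using (All; []; _∷_)
import Data.List.Relation.Unary.All.Properties as All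
open import Data.List.Relation.Unary.AllPairs as AllPairs using (AllPairs; []; _∷_)
import Data.List.Relation.Unary.AllPairs.Properties as AllPairs
open import Data.List.Relation.Unary.Any using (Any; here)
import Data.List.Relation.Unary.Any.Properties as Any
open import Data.List.Relation.Unary.Enumerates.Setoid using (IsEnumeration)
import Data.List.Relation.Unary.Unique.Propositional.Properties as Unique
open import Data.Nat.Base using (ℕ; zero; suc; _+_; _*_; _^_; _≤_; _<_; z≤n; s≤s)
open import Data.Nat.Properties
  using (suc-injective; ≤-trans; ≤-reflexive; +-suc; +-mono-<; <⇒≱; _≤?_; ≰⇒>; anyUpTo?)
open import Data.Product.Base using (Σ; _×_; _,_; proj₁; proj₂; ∃-syntax)
open import Data.Sum.Base using (_⊎_; inj₁; inj₂; [_,_]′)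
open import Data.Unit.Base using (tt)
open import Function.Base using (flip; _∘_; id)
open import Function.Construct.Identity using (↔-id)
open import Function.Definitions using (Injective)
open import Level using (0ℓ)
open import Relation.Binary.Bundles using (Setoid)
open import Relation.Binary.Core using (Rel)
open import Relation.Binary.Definitions using (DecidableEquality; Decidable)
open import Relation.Binary.PropositionalEquality
  using (_≡_; _≢_; refl; sym; trans; cong; subst; subst₂; ≢-sym; _≗_)
open import Relation.Nullary.Decidable.Core
  using (Dec; yes; no; T?; ¬?; ⌊_⌋; toWitness; fromWitness; map′; _×-dec_; _⊎-dec_; _→-dec_)
open import Relation.Nullary.Negation.Core using (¬_; contradiction)
import Relation.Unary as Unary

-- Sublists and an ordered form of Ramsey's theorem

AllPairs-resp-⊆ : {A : Set} {R : Rel A 0ℓ} {xs ys : List A} →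
                  ys ⊆ xs → AllPairs R xs → AllPairs R ys
AllPairs-resp-⊆ []         []         = []
AllPairs-resp-⊆ (_ ∷ʳ τ)   (_ ∷ Rxs)  = AllPairs-resp-⊆ τ Rxs
AllPairs-resp-⊆ (refl ∷ τ) (Rx ∷ Rxs) = All-resp-⊆ τ Rx ∷ AllPairs-resp-⊆ τ Rxs

AllPairs-reverse⁺ : {A : Set} {R : Rel A 0ℓ} {xs : List A} →
                    AllPairs R xs → AllPairs (flip R) (reverse xs)
AllPairs-reverse⁺ [] = []
AllPairs-reverse⁺ {R = R} {x ∷ xs} (Rx ∷ Rxs) =
  subst (AllPairs (flip R)) (sym (unfold-reverse x xs))
    (AllPairs.++⁺ (AllPairs-reverse⁺ Rxs) ([] ∷ [])
      (All.tabulate λ y∈ → All.lookup Rx (Any.reverse⁻ y∈) ∷ []))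

length-filter-¬ : {A : Set} {P : A → Set} (P? : Unary.Decidable P) (xs : List A) →
                  length (filter P? xs) + length (filter (¬? ∘ P?) xs) ≡ length xs
length-filter-¬ P? [] = refl
length-filter-¬ P? (x ∷ xs) with P? x
... | yes _ = cong suc (length-filter-¬ P? xs)
... | no  _ = trans (+-suc _ _) (cong suc (length-filter-¬ P? xs))

+-≤-pigeonhole : ∀ m n {p q} → m + n ≤ p + q → m ≤ p ⊎ n ≤ q
+-≤-pigeonhole m n {p} {q} m+n≤p+q with m ≤? p | n ≤? q
... | yes m≤p | _       = inj₁ m≤p
... | no _    | yes n≤q = inj₂ n≤q
... | no m≰p  | no n≰q  = contradiction m+n≤p+q (<⇒≱ (+-mono-< (≰⇒> m≰p) (≰⇒> n≰q)))

AllPairsSublist : {A : Set} → Rel A 0ℓ → ℕ → List A → Set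
AllPairsSublist R k xs = ∃[ ys ] (ys ⊆ xs × length ys ≡ k × AllPairs R ys)

infix 10 ∁_
∁_ : {A : Set} → Rel A 0ℓ → Rel A 0ℓ
(∁ R) x y = ¬ R x y

-- Opaque because the bounds built from it are astronomically large.

opaque
  ramseyBound : ℕ → ℕ → ℕ
  ramseyBound zero    _       = 0
  ramseyBound (suc a) zero    = 0
  ramseyBound (suc a) (suc b) = suc (ramseyBound a (suc b) + ramseyBound (suc a) b)

  -- `R` need not be symmetric: it is only tested from an entry to a later one. The tail splits into
  -- the entries related to the head `x` and the others, and one of the two parts is long enough for
  -- the recursion; `x` joins the sublist found there if that sublist is of the matching kind.
  ramsey : {A : Set} {R : Rel A 0ℓ} → Decidable R →
           ∀ a b xs → ramseyBound a b ≤ length xs →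
           AllPairsSublist R a xs ⊎ AllPairsSublist (∁ R) b xs
  ramsey R? zero    b       xs _ = inj₁ ([] , minimum xs , refl , [])
  ramsey R? (suc a) zero    xs _ = inj₂ ([] , minimum xs , refl , [])
  ramsey R? (suc a) (suc b) (x ∷ xs) (s≤s bound≤)
    with +-≤-pigeonhole (ramseyBound a (suc b)) (ramseyBound (suc a) b)
           (≤-trans bound≤ (≤-reflexive (sym (length-filter-¬ (R? x) xs))))
  ... | inj₁ bound≤ᴿ with ramsey R? a (suc b) (filter (R? x) xs) bound≤ᴿ
  ...   | inj₁ (ys , τ , refl , Rys) =
          inj₁ (x ∷ ys , refl ∷ ⊆-trans τ (filter-⊆ (R? x) xs) , refl
               , All-resp-⊆ τ (All.all-filter (R? x) xs) ∷ Rys)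
  ...   | inj₂ (ys , τ , rest) = inj₂ (ys , x ∷ʳ ⊆-trans τ (filter-⊆ (R? x) xs) , rest)
  ramsey R? (suc a) (suc b) (x ∷ xs) (s≤s bound≤)
      | inj₂ bound≤ᶜ with ramsey R? (suc a) b (filter (¬? ∘ R? x) xs) bound≤ᶜ
  ...   | inj₁ (ys , τ , rest) = inj₁ (ys , x ∷ʳ ⊆-trans τ (filter-⊆ (¬? ∘ R? x) xs) , rest)
  ...   | inj₂ (ys , τ , refl , Rys) =
          inj₂ (x ∷ ys , refl ∷ ⊆-trans τ (filter-⊆ (¬? ∘ R? x) xs) , refl
               , All-resp-⊆ τ (All.all-filter (¬? ∘ R? x) xs) ∷ Rys)

-- Colourings of a digraph minus an arc

⟶⇒≢ : {V : Set} (D : Digraph V) {u v : V} → Digraph._⟶_ D u v → u ≢ v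
⟶⇒≢ D u⟶u refl = Digraph.loopless D _ u⟶u

reverseArcs : {V : Set} → Digraph V → Digraph V
reverseArcs D = record { arc = flip arc ; loopless = loopless }
  where open Digraph D

-- What is used of a 2-dicolouring of D minus the arc u ⟶ v.

record CriticalColouring {V : Set} (D : Digraph V) (u v : V) : Set where
  open Digraph D

  Avoiding : Rel V 0ℓ
  Avoiding p q = p ⟶ q × (p ≡ u → q ≢ v)

  field
    colour     : V → Fin 2
    same       : colour u ≡ colour v
    noDigon    : ∀ {p q} → Avoiding p q → Avoiding q p → colour p ≢ colour q
    noTriangle : ∀ {p q r} → Avoiding p q → Avoiding q r → Avoiding r p →
                 colour p ≡ colour q → colour q ≢ colour r
    return     : v ⟶ u ⊎ ∃[ w ] (colour w ≡ colour u × v ⟶ w × w ⟶ u)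

  avoidingFrom : ∀ {p q} → p ≢ u → p ⟶ q → Avoiding p q
  avoidingFrom p≢u p⟶q = p⟶q , λ p≡u → contradiction p≡u p≢u

LocallyCritical : {V : Set} → Digraph V → Set
LocallyCritical D = ∀ {u v} → u ⟶ v → CriticalColouring D u v
  where open Digraph D

-- Digons and triangles stay such when all arcs are reversed, and by `same` it does not matter which
-- end of the arc the colour of `w` is compared with. So each bound obtained for `D` is also
-- available for `reverseArcs D`.
reverse-locallyCritical : {V : Set} (D : Digraph V) →
                          LocallyCritical D → LocallyCritical (reverseArcs D)
reverse-locallyCritical D critical {u} {v} v⟶u = record
  { colour     = colour
  ; same       = sym same
  ; noDigon    = λ a b → noDigon (flipAvoiding b) (flipAvoiding a)
  ; noTriangle = λ a b c p≡q q≡r → noTriangle (flipAvoiding c) (flipAvoiding b) (flipAvoiding a)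
                   (trans p≡q q≡r) (sym q≡r)
  ; return     = flipReturn return
  }
  where
  open Digraph D
  open CriticalColouring (critical v⟶u)
  flipAvoiding : ∀ {p q} → q ⟶ p × (p ≡ u → q ≢ v) → Avoiding q p
  flipAvoiding (q⟶p , avoid) = q⟶p , λ q≡v p≡u → avoid p≡u q≡v
  flipReturn : u ⟶ v ⊎ ∃[ w ] (colour w ≡ colour v × u ⟶ w × w ⟶ v) →
               u ⟶ v ⊎ ∃[ w ] (colour w ≡ colour u × w ⟶ v × u ⟶ w)
  flipReturn (inj₁ u⟶v)                  = inj₁ u⟶v
  flipReturn (inj₂ (w , w≡v , u⟶w , w⟶v)) = inj₂ (w , trans w≡v same , w⟶v , u⟶w)

reverse-semiComplete : {V : Set} {D : Digraph V} → SemiComplete D → SemiComplete (reverseArcs D)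
reverse-semiComplete semi u v u≢v = semi v u (≢-sym u≢v)

≢-≢⇒≡ : {a b c : Fin 2} → a ≢ c → b ≢ c → a ≡ b
≢-≢⇒≡ {zero}     {zero}     _   _   = refl
≢-≢⇒≡ {suc zero} {suc zero} _   _   = refl
≢-≢⇒≡ {zero}     {suc zero} {zero}     a≢c _   = contradiction refl a≢c
≢-≢⇒≡ {zero}     {suc zero} {suc zero} _   b≢c = contradiction refl b≢c
≢-≢⇒≡ {suc zero} {zero}     {zero}     _   b≢c = contradiction refl b≢c
≢-≢⇒≡ {suc zero} {zero}     {suc zero} a≢c _   = contradiction refl a≢c

-- Triangles on the arcs of a transitive tournament

◁-bound : ℕ
◁-bound = ramseyBound 7 4

module TransitiveSubtournaments {V : Set} (_≟_ : DecidableEquality V) (D : Digraph V)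
  (critical : LocallyCritical D) (semi : SemiComplete D) where

  open Digraph D

  private
    arc⇒≢ : ∀ {u v} → u ⟶ v → u ≢ v
    arc⇒≢ = ⟶⇒≢ D

  ¬⟶⇒⟵ : ∀ {u v} → u ≢ v → ¬ u ⟶ v → v ⟶ u
  ¬⟶⇒⟵ u≢v ¬u⟶v with semi _ _ u≢v
  ... | inj₁ u⟶v = contradiction u⟶v ¬u⟶v
  ... | inj₂ v⟶u = v⟶u

  -- If `a` had the colour of `u`, a monochromatic cycle avoiding `u ⟶ v` would appear: the triangle
  -- u, a, v if `v ⟶ u`; the digon u, a if `w` is `a`; otherwise a, v, w or u, a, w, depending on
  -- the arc between `w` and `a`.
  between-colour : ∀ {u v a} (u⟶v : u ⟶ v) → u ⟶ a → a ⟶ v →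
                   CriticalColouring.colour (critical u⟶v) a ≢
                   CriticalColouring.colour (critical u⟶v) u
  between-colour {u} {v} {a} u⟶v u⟶a a⟶v a≡u = case return
    where
    open CriticalColouring (critical u⟶v)
    u⇢a : Avoiding u a
    u⇢a = u⟶a , λ _ → arc⇒≢ a⟶v
    a≢u = ≢-sym (arc⇒≢ u⟶a)
    v≢u = ≢-sym (arc⇒≢ u⟶v)
    case : v ⟶ u ⊎ ∃[ w ] (colour w ≡ colour u × v ⟶ w × w ⟶ u) → ⊥
    case (inj₁ v⟶u) = noTriangle u⇢a (avoidingFrom a≢u a⟶v) (avoidingFrom v≢u v⟶u)
                        (sym a≡u) (trans a≡u same)
    case (inj₂ (w , w≡u , v⟶w , w⟶u)) with w ≟ a
    ... | yes refl = noDigon u⇢a (avoidingFrom a≢u w⟶u) (sym a≡u)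
    ... | no w≢a with semi w a w≢a
    ...   | inj₁ w⟶a = noTriangle (avoidingFrom a≢u a⟶v) (avoidingFrom v≢u v⟶w)
                         (avoidingFrom (arc⇒≢ w⟶u) w⟶a) (trans a≡u same) (sym (trans w≡u same))
    ...   | inj₂ a⟶w = noTriangle u⇢a (avoidingFrom a≢u a⟶w)
                         (avoidingFrom (arc⇒≢ w⟶u) w⟶u) (sym a≡u) (trans a≡u (sym w≡u))

  -- With two colours, `between-colour` gives all vertices between `u` and `v` the same colour. None
  -- of them is `u`, so a digon or triangle on them would be monochromatic and avoid `u ⟶ v`.
  between-digonFree : ∀ {u v p q} → u ⟶ v → p ⟶ q → q ⟶ p →
                      u ⟶ p → u ⟶ q → p ⟶ v → q ⟶ v → ⊥
  between-digonFree u⟶v p⟶q q⟶p u⟶p u⟶q p⟶v q⟶v =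
    noDigon (from u⟶p p⟶q) (from u⟶q q⟶p)
      (≢-≢⇒≡ (between-colour u⟶v u⟶p p⟶v) (between-colour u⟶v u⟶q q⟶v))
    where
    open CriticalColouring (critical u⟶v)
    from : ∀ {a b} → _ ⟶ a → a ⟶ b → Avoiding a b
    from u⟶a = avoidingFrom (≢-sym (arc⇒≢ u⟶a))

  between-triangleFree : ∀ {u v p q r} → u ⟶ v → p ⟶ q → q ⟶ r → r ⟶ p →
                         u ⟶ p → u ⟶ q → u ⟶ r → p ⟶ v → q ⟶ v → r ⟶ v → ⊥
  between-triangleFree u⟶v p⟶q q⟶r r⟶p u⟶p u⟶q u⟶r p⟶v q⟶v r⟶v =
    noTriangle (from u⟶p p⟶q) (from u⟶q q⟶r) (from u⟶r r⟶p)
      (≢-≢⇒≡ (between-colour u⟶v u⟶p p⟶v) (between-colour u⟶v u⟶q q⟶v))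
      (≢-≢⇒≡ (between-colour u⟶v u⟶q q⟶v) (between-colour u⟶v u⟶r r⟶v))
    where
    open CriticalColouring (critical u⟶v)
    from : ∀ {a b} → _ ⟶ a → a ⟶ b → Avoiding a b
    from u⟶a = avoidingFrom (≢-sym (arc⇒≢ u⟶a))

  infix 4 _⇒_
  _⇒_ : Rel V 0ℓ
  u ⇒ v = u ⟶ v × ¬ v ⟶ u

  record Triangle : Set where
    field
      {x y z} : V
      x⟶z     : x ⟶ z
      z⟶y     : z ⟶ y
      y⟶x     : y ⟶ x

  open Triangle

  infix 4 _≺_ _◁_ _▷▷_ _◁◁_

  -- In a list ordered by `_≺_` the vertices x₁, z₁, x₂, z₂, ... form a transitive tournament; the
  -- arcs at the apexes `y` are left open.
  record _≺_ (s t : Triangle) : Set where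
    constructor before
    field
      xx : x s ⇒ x t
      xz : x s ⇒ z t
      zx : z s ⇒ x t
      zz : z s ⇒ z t

  apex : ∀ {u v} → u ⇒ v → ∃[ w ] (v ⟶ w × w ⟶ u)
  apex (u⟶v , ¬v⟶u) with CriticalColouring.return (critical u⟶v)
  ... | inj₁ v⟶u                 = contradiction v⟶u ¬v⟶u
  ... | inj₂ (w , _ , v⟶w , w⟶u) = w , v⟶w , w⟶u

  triangleOn : ∀ {u v} → u ⇒ v → Triangle
  triangleOn u⇒v@(u⟶v , _) = let (_ , v⟶w , w⟶u) = apex u⇒v in
    record { x⟶z = u⟶v ; z⟶y = v⟶w ; y⟶x = w⟶u }

  triangles : ∀ {us} → AllPairs _⇒_ us → List Triangle
  triangles []                      = []
  triangles (_ ∷ [])                = []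
  triangles ((u⇒v ∷ _) ∷ (_ ∷ ⇒us)) = triangleOn u⇒v ∷ triangles ⇒us

  triangles-All : ∀ {us} {P : V → Set} (⇒us : AllPairs _⇒_ us) → All P us →
                  All (λ t → P (x t) × P (z t)) (triangles ⇒us)
  triangles-All []                        []             = []
  triangles-All (_ ∷ [])                  (_ ∷ [])       = []
  triangles-All {P = P} ((u⇒v ∷ _) ∷ (_ ∷ ⇒us)) (pu ∷ pv ∷ ps) =
    (pu , pv) ∷ triangles-All ⇒us ps

  triangles-≺ : ∀ {us} (⇒us : AllPairs _⇒_ us) → AllPairs _≺_ (triangles ⇒us)
  triangles-≺ []                        = []
  triangles-≺ (_ ∷ [])                  = []
  triangles-≺ ((u⇒v ∷ u⇒us) ∷ (v⇒us ∷ ⇒us)) =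
    All.zipWith (λ ((ux , uz) , (vx , vz)) → before ux uz vx vz)
      (triangles-All ⇒us u⇒us , triangles-All ⇒us v⇒us) ∷ triangles-≺ ⇒us

  triangles-length : ∀ k {us} (⇒us : AllPairs _⇒_ us) → k * 2 ≤ length us →
                     k ≤ length (triangles ⇒us)
  triangles-length zero    _                       _                 = z≤n
  triangles-length (suc k) (_ ∷ [])                (s≤s ())
  triangles-length (suc k) ((_ ∷ _) ∷ (_ ∷ ⇒us)) (s≤s (s≤s 2k≤)) = s≤s (triangles-length k ⇒us 2k≤)

  -- In a list ordered by _◁_ every yᵢ sends arcs to all earlier zⱼ; the two
  -- refinements differ in its arcs with the later zⱼ.

  record _◁_ (s t : Triangle) : Set where
    field
      s≺t : s ≺ t
      ¬zy : ¬ z s ⟶ y t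

    open _≺_ s≺t
    zz⟶ : z s ⟶ z t
    zz⟶ = proj₁ zz
    yz : y t ⟶ z s
    -- If `y t` were `z s`, then `z t ⟶ z s`, against `zz`.
    yz = ¬⟶⇒⟵ (λ { refl → proj₂ zz (z⟶y t) }) ¬zy
    y≢y : y s ≢ y t
    y≢y eq = ¬zy (subst (z s ⟶_) eq (z⟶y s))

  _▷▷_ : Rel Triangle 0ℓ
  s ▷▷ t = s ◁ t × z t ⟶ y s

  _◁◁_ : Rel Triangle 0ℓ
  s ◁◁ t = s ◁ t × y s ⟶ z t

  -- If `y b ⟶ y c`, the triangle z a, z c, y c lies between the ends of `y b ⟶ z d`. Otherwise z a,
  -- z b, y b lies between the ends of `y c ⟶ z d`.
  ◁◁-short : ∀ {a b c d} → ¬ AllPairs _◁◁_ (a ∷ b ∷ c ∷ d ∷ [])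
  ◁◁-short {a} {b} {c} {d}
    (((ab , _) ∷ (ac , _) ∷ (ad , _) ∷ [])
      ∷ ((bc , bc') ∷ (bd , bd') ∷ []) ∷ ((cd , cd') ∷ []) ∷ [] ∷ [])
    with semi (y b) (y c) (_◁_.y≢y bc)
  ... | inj₁ yb⟶yc =
    between-triangleFree bd' (_◁_.zz⟶ ac) (z⟶y c) (_◁_.yz ac)
      (_◁_.yz ab) bc' yb⟶yc (_◁_.zz⟶ ad) (_◁_.zz⟶ cd) cd'
  ... | inj₂ yc⟶yb =
    between-triangleFree cd' (_◁_.zz⟶ ab) (z⟶y b) (_◁_.yz ab)
      (_◁_.yz ac) (_◁_.yz bc) yc⟶yb (_◁_.zz⟶ ad) (_◁_.zz⟶ bd) bd'

  -- Let z b and z e have colour red.  The triangle z c, z d, y d forces y d to be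
  -- red, and then y b and z a are blue because of triangles through y d.  But
  -- z a, z c, y b is a triangle.

  ▷▷-apexes : ∀ {a b c d e} → AllPairs _▷▷_ (a ∷ b ∷ c ∷ d ∷ e ∷ []) → ¬ y b ⟶ y d
  ▷▷-apexes {a} {b} {c} {d} {e}
    (((ab , _) ∷ (ac , _) ∷ (ad , _) ∷ (ae , _) ∷ [])
      ∷ ((bc , bc') ∷ (bd , _) ∷ (be , be') ∷ [])
      ∷ ((cd , _) ∷ (ce , _) ∷ []) ∷ ((de , de') ∷ []) ∷ [] ∷ []) yb⟶yd =
    noTriangle (avoidingFrom (arc⇒≢ (_◁_.zz⟶ ab)) (_◁_.zz⟶ ac))
               (avoidingFrom (≢-sym (arc⇒≢ (_◁_.zz⟶ bc))) bc')
               (avoidingFrom (≢-sym (arc⇒≢ (z⟶y b))) (_◁_.yz ab))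
               (≢-≢⇒≡ za≢ zc≢) (≢-≢⇒≡ zc≢ yb≢)
    where
    zb⟶ze : z b ⟶ z e
    zb⟶ze = _◁_.zz⟶ be
    open CriticalColouring (critical zb⟶ze)
    yd≢zb : y d ≢ z b
    yd≢zb = arc⇒≢ (_◁_.yz bd)
    zc≢ : colour (z c) ≢ colour (z b)
    zc≢ = between-colour zb⟶ze (_◁_.zz⟶ bc) (_◁_.zz⟶ ce)
    zd≢ : colour (z d) ≢ colour (z b)
    zd≢ = between-colour zb⟶ze (_◁_.zz⟶ bd) (_◁_.zz⟶ de)
    yd≡ : colour (y d) ≡ colour (z b)
    yd≡ with colour (y d) Fin.≟ colour (z b)
    ... | yes eq = eq
    ... | no yd≢ = contradiction (≢-≢⇒≡ zd≢ yd≢) (noTriangle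
            (avoidingFrom (≢-sym (arc⇒≢ (_◁_.zz⟶ bc))) (_◁_.zz⟶ cd))
            (avoidingFrom (≢-sym (arc⇒≢ (_◁_.zz⟶ bd))) (z⟶y d))
            (avoidingFrom yd≢zb (_◁_.yz cd))
            (≢-≢⇒≡ zc≢ zd≢))
    yb≢ : colour (y b) ≢ colour (z b)
    yb≢ yb≡ = noTriangle
      (z⟶y b , λ _ → ≢-sym (arc⇒≢ be'))
      (avoidingFrom (≢-sym (arc⇒≢ (z⟶y b))) yb⟶yd)
      (avoidingFrom yd≢zb (_◁_.yz bd))
      (sym yb≡) (trans yb≡ (sym yd≡))
    za≢ : colour (z a) ≢ colour (z b)
    za≢ za≡ = noTriangle
      (avoidingFrom yd≢zb (_◁_.yz ad))
      (avoidingFrom (arc⇒≢ (_◁_.zz⟶ ab)) (_◁_.zz⟶ ae))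
      (avoidingFrom (≢-sym (arc⇒≢ zb⟶ze)) de')
      (trans yd≡ (sym za≡)) (trans za≡ same)

  -- By `▷▷-apexes` the arcs among y b, y d, y f all go backwards, which puts the triangle z b, z d,
  -- y d between the ends of `y f ⟶ y b`. Each use of `▷▷-apexes` needs an entry before, between and
  -- after its pair; a, c, e and g supply these.
  ▷▷-short : ∀ {a b c d e f g} → ¬ AllPairs _▷▷_ (a ∷ b ∷ c ∷ d ∷ e ∷ f ∷ g ∷ [])
  ▷▷-short {a} {b} {c} {d} {e} {f} {g}
    ps@(_ ∷ (_ ∷ bd ∷ _ ∷ bf ∷ _) ∷ _ ∷ (_ ∷ df ∷ _) ∷ _) =
    between-triangleFree (back bf bf≁) (_◁_.zz⟶ (proj₁ bd)) (z⟶y d) (_◁_.yz (proj₁ bd))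
      (_◁_.yz (proj₁ bf)) (_◁_.yz (proj₁ df)) (back df df≁)
      (z⟶y b) (proj₂ bd) (back bd bd≁)
    where
    back : ∀ {s t} → s ▷▷ t → ¬ y s ⟶ y t → y t ⟶ y s
    back (s◁t , _) = ¬⟶⇒⟵ (_◁_.y≢y s◁t)
    skip : ∀ {t} {ts us : List Triangle} → us ⊆ ts → us ⊆ t ∷ ts
    skip = _ ∷ʳ_
    keep : ∀ {t} {ts us : List Triangle} → us ⊆ ts → t ∷ us ⊆ t ∷ ts
    keep = refl ∷_
    bd≁ : ¬ y b ⟶ y d
    bd≁ = ▷▷-apexes (AllPairs-resp-⊆ (keep (keep (keep (keep (keep (skip (skip []))))))) ps)
    bf≁ : ¬ y b ⟶ y f
    bf≁ = ▷▷-apexes (AllPairs-resp-⊆ (keep (keep (keep (skip (skip (keep (keep []))))))) ps)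
    df≁ : ¬ y d ⟶ y f
    df≁ = ▷▷-apexes (AllPairs-resp-⊆ (skip (skip (keep (keep (keep (keep (keep []))))))) ps)

  ◁-bounded : ∀ {ts} → AllPairs _◁_ ts → ¬ ◁-bound ≤ length ts
  ◁-bounded {ts} ◁ts bound≤
    -- 7 and 4 are the lengths excluded by `▷▷-short` and `◁◁-short`.
    with ramsey {R = λ s t → z t ⟶ y s} (λ s t → T? (arc (z t) (y s))) 7 4 ts bound≤
  ... | inj₁ (_ ∷ _ ∷ _ ∷ _ ∷ _ ∷ _ ∷ _ ∷ [] , τ , refl , R) =
    ▷▷-short (AllPairs.zip (AllPairs-resp-⊆ τ ◁ts , R))
  ... | inj₂ (_ ∷ _ ∷ _ ∷ _ ∷ [] , τ , refl , ¬R) =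
    ◁◁-short (AllPairs.zipWith (λ (s◁t , ¬zy) → s◁t , forward s◁t ¬zy) (AllPairs-resp-⊆ τ ◁ts , ¬R))
    where
    forward : ∀ {s t} → s ◁ t → ¬ z t ⟶ y s → y s ⟶ z t
    -- If `y s` were `z t`, then `z t ⟶ x s`, against `xz`.
    forward {s} s◁t = ¬⟶⇒⟵ λ { refl → proj₂ (_≺_.xz (_◁_.s≺t s◁t)) (y⟶x s) }

  -- Otherwise the whole triangle `t` lies between the ends of `z s ⟶ x u`.
  inner-arc : ∀ {s t u} → s ≺ t → s ≺ u → t ≺ u → z s ⟶ y t → ¬ y t ⟶ x u
  inner-arc {t = t} st su tu zs⟶yt yt⟶xu =
    between-triangleFree (proj₁ (_≺_.zx su)) (x⟶z t) (z⟶y t) (y⟶x t)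
      (proj₁ (_≺_.zx st)) (proj₁ (_≺_.zz st)) zs⟶yt
      (proj₁ (_≺_.xx tu)) (proj₁ (_≺_.zx tu)) yt⟶xu

-- Bounds on the order

≺-bound : ℕ
≺-bound = ramseyBound (suc ◁-bound) ◁-bound

⇒-bound : ℕ
⇒-bound = ≺-bound * 2

⟶-bound : ℕ
⟶-bound = ramseyBound 4 ⇒-bound

vertexBound : ℕ
vertexBound = ramseyBound ⟶-bound ⇒-bound

module _ {V : Set} (_≟_ : DecidableEquality V) (D : Digraph V)
  (critical : LocallyCritical D) (semi : SemiComplete D) where

  open Digraph D
  open TransitiveSubtournaments _≟_ D critical semi
  private
    module ᵒ = TransitiveSubtournaments _≟_ (reverseArcs D)
      (reverse-locallyCritical D critical) (reverse-semiComplete {D = D} semi)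

    -- The implicit vertices show the effect of reversal: `x` and `z` change places and `y` stays.
    reverseTriangle : Triangle → ᵒ.Triangle
    reverseTriangle t =
      record { x⟶z = Triangle.x⟶z t ; z⟶y = Triangle.y⟶x t ; y⟶x = Triangle.z⟶y t }

  open Triangle

  ≺-bounded : ∀ {ts} → AllPairs _≺_ ts → ¬ ≺-bound ≤ length ts
  ≺-bounded {ts} ≺ts bound≤
    -- The extra entry in `suc ◁-bound` is the first triangle `s`, which is spent as the one in
    -- front in `inner-arc`.
    with ramsey {R = λ s t → z s ⟶ y t} (λ s t → T? (arc (z s) (y t)))
           (suc ◁-bound) ◁-bound ts bound≤
  ... | inj₂ (us , τ , len , ¬R) =
    ◁-bounded (AllPairs.zipWith (λ (s≺t , ¬zy) → record { s≺t = s≺t ; ¬zy = ¬zy })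
                (AllPairs-resp-⊆ τ ≺ts , ¬R))
      (≤-reflexive (sym len))
  -- By inner-arc with s in front, t ≺ u excludes y t ⟶ x u; reversing the arcs
  -- and the list leads back to the case above.
  ... | inj₁ (s ∷ us , τ , len , zy ∷ _) with s≺us ∷ ≺us ← AllPairs-resp-⊆ τ ≺ts =
    ᵒ.◁-bounded
      (AllPairs.map⁺ (AllPairs-reverse⁺ (reversed s≺us zy ≺us)))
      (≤-reflexive (sym (trans (length-map _ (reverse us))
        (trans (length-reverse us) (suc-injective len)))))
    where
    reversed₁ : ∀ {t us} → s ≺ t → z s ⟶ y t → All (s ≺_) us → All (t ≺_) us →
                All (λ u → reverseTriangle u ᵒ.◁ reverseTriangle t) us
    reversed₁ st zy su tu = All.zipWith
      (λ (su , tu) → record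
        -- As `x` and `z` change places, `xx` and `zz` are exchanged, and `¬zy` reads as the absence
        -- of `y t ⟶ x u` in `D`.
        { s≺t = ᵒ.before (_≺_.zz tu) (_≺_.xz tu) (_≺_.zx tu) (_≺_.xx tu)
        ; ¬zy = inner-arc st su tu zy })
      (su , tu)
    reversed : ∀ {us} → All (s ≺_) us → All (λ t → z s ⟶ y t) us → AllPairs _≺_ us →
               AllPairs (λ t u → reverseTriangle u ᵒ.◁ reverseTriangle t) us
    reversed []        []        []        = []
    reversed (st ∷ su) (zy ∷ zys) (tu ∷ us) = reversed₁ st zy su tu ∷ reversed su zys us

  ⇒-bounded : ∀ {us} → AllPairs _⇒_ us → ¬ ⇒-bound ≤ length us
  ⇒-bounded ⇒us bound≤ = ≺-bounded (triangles-≺ ⇒us) (triangles-length ≺-bound ⇒us bound≤)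

  -- Four vertices a, b, c, d joined pairwise by digons put the digon b, c between the ends of
  -- `a ⟶ d`. So Ramsey's theorem leaves a long sublist without digons.
  ⟶-bounded : ∀ {us} → AllPairs _⟶_ us → ¬ ⟶-bound ≤ length us
  ⟶-bounded {us} ⟶us bound≤
    with ramsey {R = λ u v → v ⟶ u} (λ u v → T? (arc v u)) 4 ⇒-bound us bound≤
  ... | inj₂ (vs , τ , len , ¬⟵vs) =
    ⇒-bounded (AllPairs.zip (AllPairs-resp-⊆ τ ⟶us , ¬⟵vs)) (≤-reflexive (sym len))
  ... | inj₁ (a ∷ b ∷ c ∷ d ∷ [] , τ , refl , ⟵vs)
    with (ab ∷ ac ∷ ad ∷ []) ∷ (bc ∷ bd ∷ []) ∷ (cd ∷ []) ∷ [] ∷ [] ← AllPairs-resp-⊆ τ ⟶us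
       | (ba ∷ ca ∷ da ∷ []) ∷ (cb ∷ db ∷ []) ∷ (dc ∷ []) ∷ [] ∷ [] ← ⟵vs =
    between-digonFree ad bc cb ab ac bd cd

module _ {V : Set} (_≟_ : DecidableEquality V) (D : Digraph V)
  (critical : LocallyCritical D) (semi : SemiComplete D) where

  open Digraph D
  open TransitiveSubtournaments _≟_ D critical semi

  -- Ramsey's theorem yields a sublist with all arcs forward or one with none forward. In the latter
  -- all arcs go backward and there are no digons, so it is ordered by `_⇒_` in the reversed
  -- digraph.
  order-bounded : ∀ {vs} → AllPairs _≢_ vs → length vs < vertexBound
  order-bounded {vs} ≢vs = ≰⇒> λ bound≤ →
    case (ramsey {R = _⟶_} (λ u v → T? (arc u v)) ⟶-bound ⇒-bound vs bound≤)
    where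
    case : AllPairsSublist _⟶_ ⟶-bound vs ⊎ AllPairsSublist (∁ _⟶_) ⇒-bound vs → ⊥
    case (inj₁ (us , τ , len , ⟶us)) =
      ⟶-bounded _≟_ D critical semi ⟶us (≤-reflexive (sym len))
    case (inj₂ (us , τ , len , ¬⟶us)) =
      ⇒-bounded _≟_ (reverseArcs D) (reverse-locallyCritical D critical)
        (reverse-semiComplete {D = D} semi)
        (AllPairs.zipWith (λ (u≢v , ¬u⟶v) → ¬⟶⇒⟵ u≢v ¬u⟶v , ¬u⟶v) (AllPairs-resp-⊆ τ ≢vs , ¬⟶us))
        (≤-reflexive (sym len))

-- Short cycles and transport of dicolourings

members-≡ : {V : Set} {P : V → Bool} {u v : Σ V (T ∘ P)} → proj₁ u ≡ proj₁ v → u ≡ v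
members-≡ {u = a , p} {.a , q} refl = cong (a ,_) (T-irrelevant p q)

module _ {V : Set} (D : Digraph V) where
  open Digraph D

  digonCycle : ∀ {p q} → p ⟶ q → q ⟶ p → DirectedCycle D
  digonCycle {p} {q} p⟶q q⟶p = record
    { m = 1 ; vertex = vertex ; injective = injective
    ; step = λ { zero → p⟶q } ; close = q⟶p }
    where
    vertex : Fin 2 → V
    vertex zero       = p
    vertex (suc zero) = q
    injective : Injective _≡_ _≡_ vertex
    injective {zero}     {zero}     _  = refl
    injective {zero}     {suc zero} eq = contradiction eq (⟶⇒≢ D p⟶q)
    injective {suc zero} {zero}     eq = contradiction eq (⟶⇒≢ D q⟶p)
    injective {suc zero} {suc zero} _  = refl

  triangleCycle : ∀ {p q r} → p ⟶ q → q ⟶ r → r ⟶ p → DirectedCycle D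
  triangleCycle {p} {q} {r} p⟶q q⟶r r⟶p = record
    { m = 2 ; vertex = vertex ; injective = injective
    ; step = λ { zero → p⟶q ; (suc zero) → q⟶r } ; close = r⟶p }
    where
    vertex : Fin 3 → V
    vertex zero             = p
    vertex (suc zero)       = q
    vertex (suc (suc zero)) = r
    injective : Injective _≡_ _≡_ vertex
    injective {zero}           {zero}           _  = refl
    injective {zero}           {suc zero}       eq = contradiction eq (⟶⇒≢ D p⟶q)
    injective {zero}           {suc (suc zero)} eq = contradiction (sym eq) (⟶⇒≢ D r⟶p)
    injective {suc zero}       {zero}           eq = contradiction (sym eq) (⟶⇒≢ D p⟶q)
    injective {suc zero}       {suc zero}       _  = refl
    injective {suc zero}       {suc (suc zero)} eq = contradiction eq (⟶⇒≢ D q⟶r)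
    injective {suc (suc zero)} {zero}           eq = contradiction eq (⟶⇒≢ D r⟶p)
    injective {suc (suc zero)} {suc zero}       eq = contradiction (sym eq) (⟶⇒≢ D q⟶r)
    injective {suc (suc zero)} {suc (suc zero)} _  = refl

  ShortCycle : Set
  ShortCycle = ∃[ p ] ∃[ q ] (p ⟶ q × q ⟶ p ⊎ ∃[ r ] (p ⟶ q × q ⟶ r × r ⟶ p))

  -- An arc joins vertices 0 and 2 of a cycle of length at least four. Directed from 0 to 2 it
  -- bypasses vertex 1 and shortens the cycle; directed from 2 to 0 it closes a triangle.
  shortCycle : SemiComplete D → DirectedCycle D → ShortCycle
  shortCycle semi C = shorten m vertex injective step close
    where
    open DirectedCycle C
    shorten : ∀ m (vertex : Fin (suc m) → V) → Injective _≡_ _≡_ vertex →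
              (∀ i → vertex (inject₁ i) ⟶ vertex (suc i)) → vertex (fromℕ m) ⟶ vertex zero →
              ShortCycle
    shorten 0 vertex inj step close = contradiction refl (⟶⇒≢ D close)
    shorten 1 vertex inj step close = _ , _ , inj₁ (step zero , close)
    shorten 2 vertex inj step close = _ , _ , inj₂ (_ , step zero , step (suc zero) , close)
    shorten (suc (suc (suc m))) vertex inj step close =
      [ (λ chord → shorten (suc (suc m)) (vertex ∘ punchIn (suc zero))
          (λ eq → Fin.punchIn-injective (suc zero) _ _ (inj eq))
          (λ { zero → chord ; (suc i) → step (suc (suc i)) })
          close)
      , (λ chord → _ , _ , inj₂ (_ , step zero , step (suc zero) , chord))
      ]′ (semi (vertex zero) (vertex (suc (suc zero))) (λ eq → contradiction (inj eq) λ ()))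

-- An injective map that preserves arcs carries cycles to cycles. The arc condition may use the
-- membership of both ends, so an arc missing from `E` does no harm if its ends are not both in `P`.
acyclic-pullback : {V W : Set} {D : Digraph V} {E : Digraph W} {P : V → Bool} {Q : W → Bool}
  (f : V → W) → Injective _≡_ _≡_ f → (∀ {v} → T (P v) → T (Q (f v))) →
  (∀ {u v} → T (P u) → T (P v) → Digraph._⟶_ D u v → Digraph._⟶_ E (f u) (f v)) →
  Acyclic (E [ Q ]) → Acyclic (D [ P ])
acyclic-pullback f f-inj f-mem f-arc acyclic C = acyclic record
  { m         = m
  ; vertex    = λ i → f (proj₁ (vertex i)) , f-mem (proj₂ (vertex i))
  ; injective = λ eq → injective (members-≡ (f-inj (cong proj₁ eq)))
  ; step      = λ i → f-arc (proj₂ (vertex (inject₁ i))) (proj₂ (vertex (suc i))) (step i)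
  ; close     = f-arc (proj₂ (vertex (fromℕ m))) (proj₂ (vertex zero)) close
  }
  where open DirectedCycle C

dicolourable-pullback : {V W : Set} {k : ℕ} {D : Digraph V} {E : Digraph W}
  (f : V → W) → Injective _≡_ _≡_ f →
  (∀ {u v} → Digraph._⟶_ D u v → Digraph._⟶_ E (f u) (f v)) →
  Dicolourable k E → Dicolourable k D
dicolourable-pullback {D = D} {E} f f-inj f-arc (φ , φ-dicolouring) =
  φ ∘ f , λ c → acyclic-pullback {D = D} {E} f f-inj id (λ _ _ → f-arc) (φ-dicolouring c)

semiComplete-[] : {V : Set} {D : Digraph V} (P : V → Bool) → SemiComplete D → SemiComplete (D [ P ])
semiComplete-[] P semi u v u≢v = semi (proj₁ u) (proj₁ v) (u≢v ∘ members-≡)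

-- Criticality with respect to single arcs

module _ {n : ℕ} (D : Digraph (Fin n)) where
  open Digraph D

  avoiding? : ∀ u v p q → Dec (p ⟶ q × (p ≡ u → q ≢ v))
  avoiding? u v p q = T? (arc p q) ×-dec (p Fin.≟ u →-dec ¬? (q Fin.≟ v))

  deleteArc : Fin n → Fin n → Digraph (Fin n)
  deleteArc u v = record
    { arc      = λ p q → ⌊ avoiding? u v p q ⌋
    ; loopless = λ p p⟶p → loopless p (proj₁ (toWitness p⟶p))
    }

  -- Among semi-complete digraphs this is equivalent to ThreeDicritical, and it
  -- quantifies over arcs instead of over subdigraphs.

  ArcCritical : Set
  ArcCritical = SemiComplete D × ¬ Dicolourable 2 D ×
    (∀ u v → u ⟶ v → Dicolourable 2 (deleteArc u v))

  -- The colouring of `deleteArc u v` cannot be a dicolouring of `D`, so some colour class has a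
  -- cycle through `u ⟶ v`. This forces `same`, and since the class is semi-complete the cycle may
  -- be taken to be a digon or a triangle, which gives `return`.
  arcCritical⇒locallyCritical : ArcCritical → LocallyCritical D
  arcCritical⇒locallyCritical (semi , ¬dicolourable , deletable) {u} {v} u⟶v = record
    { colour = φ ; same = same ; noDigon = noDigon ; noTriangle = noTriangle ; return = return }
    where
    φ = proj₁ (deletable u v u⟶v)
    φ-dicolouring = proj₂ (deletable u v u⟶v)

    Avoiding : Fin n → Fin n → Set
    Avoiding p q = p ⟶ q × (p ≡ u → q ≢ v)

    class : Fin 2 → Fin n → Bool
    class c p = ⌊ φ p Fin.≟ c ⌋

    noDigon : ∀ {p q} → Avoiding p q → Avoiding q p → φ p ≢ φ q
    noDigon {p} {q} pq qp φp≡φq =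
      φ-dicolouring (φ q) (digonCycle (deleteArc u v [ class (φ q) ])
        {p , fromWitness φp≡φq} {q , fromWitness refl} (fromWitness pq) (fromWitness qp))

    noTriangle : ∀ {p q r} → Avoiding p q → Avoiding q r → Avoiding r p → φ p ≡ φ q → φ q ≢ φ r
    noTriangle {p} {q} {r} pq qr rp φp≡φq φq≡φr =
      φ-dicolouring (φ q) (triangleCycle (deleteArc u v [ class (φ q) ])
        {p , fromWitness φp≡φq} {q , fromWitness refl} {r , fromWitness (sym φq≡φr)}
        (fromWitness pq) (fromWitness qr) (fromWitness rp))

    same : φ u ≡ φ v
    same with φ u Fin.≟ φ v
    ... | yes φu≡φv = φu≡φv
    ... | no φu≢φv  = contradiction (φ , λ c → acyclic-pullback {D = D} {deleteArc u v} id id id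
            (λ p∈c q∈c p⟶q → fromWitness (p⟶q , λ { refl refl →
              φu≢φv (trans (toWitness p∈c) (sym (toWitness q∈c))) }))
            (φ-dicolouring c)) ¬dicolourable

    return : v ⟶ u ⊎ ∃[ w ] (φ w ≡ φ u × v ⟶ w × w ⟶ u)
    -- A finite search decides both alternatives, so refuting their failure is enough.
    return with T? (arc v u)
              | Fin.any? (λ w → (φ w Fin.≟ φ u) ×-dec (T? (arc v w) ×-dec T? (arc w u)))
    ... | yes v⟶u | _           = inj₁ v⟶u
    ... | no _    | yes w       = inj₂ w
    ... | no ¬v⟶u | no ¬return = contradiction (φ , λ c C →
            noShortCycle c (shortCycle (D [ class c ]) (semiComplete-[] {D = D} (class c) semi) C))
            ¬dicolourable
      where
      noShortCycle : ∀ c → ¬ ShortCycle (D [ class c ])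
      noShortCycle c ((p , p∈) , (q , q∈) , inj₁ (p⟶q , q⟶p)) =
        noDigon (p⟶q , λ { refl refl → ¬v⟶u q⟶p }) (q⟶p , λ { refl refl → ¬v⟶u p⟶q })
          (trans (toWitness p∈) (sym (toWitness q∈)))
      noShortCycle c ((p , p∈) , (q , q∈) , inj₂ ((r , r∈) , p⟶q , q⟶r , r⟶p)) =
        noTriangle (avoid p⟶q q⟶r r⟶p r≡p) (avoid q⟶r r⟶p p⟶q (sym q≡p)) (avoid r⟶p p⟶q q⟶r q≡r)
          (sym q≡p) q≡r
        where
        r≡p = trans (toWitness r∈) (sym (toWitness p∈))
        q≡p = trans (toWitness q∈) (sym (toWitness p∈))
        q≡r = trans (toWitness q∈) (sym (toWitness r∈))
        avoid : ∀ {a b c} → a ⟶ b → b ⟶ c → c ⟶ a → φ c ≡ φ a → Avoiding a b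
        -- If the arc from `a` to `b` were `u ⟶ v`, the third vertex `c` would be the `w` that the
        -- search did not find.
        avoid a⟶b b⟶c c⟶a φc≡φa = a⟶b , λ { refl refl → ¬return (_ , φc≡φa , b⟶c , c⟶a) }

  threeDicritical⇒arcCritical : ThreeDicritical D → SemiComplete D → ArcCritical
  threeDicritical⇒arcCritical (¬dicolourable , proper) semi =
    semi , ¬dicolourable , λ u v u⟶v →
      dicolourable-pullback {D = deleteArc u v} (λ p → p , tt) (cong proj₁) id
        (proper (record
          { hasVertex = λ _ → true
          ; hasArc    = Digraph.arc (deleteArc u v)
          ; endpoints = λ _ → tt , tt
          ; arc⊆      = proj₁ ∘ toWitness
          }) (inj₂ (u , v , u⟶v , λ u⟶v → proj₂ (toWitness u⟶v) refl refl)))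

  -- A missing vertex `v` takes with it an arc joining it to any other vertex. If there is no other
  -- vertex, the constant colouring is a dicolouring of `D`.
  missingArc : SemiComplete D → ¬ Dicolourable 2 D → (H : Subdigraph D) → Subdigraph.Proper H →
               ∃[ u ] ∃[ v ] (u ⟶ v × ¬ T (Subdigraph.hasArc H u v))
  missingArc semi ¬dicolourable H (inj₂ missing) = missing
  missingArc semi ¬dicolourable H (inj₁ (v , v∉H)) with Fin.any? (λ w → ¬? (w Fin.≟ v))
  ... | yes (w , w≢v) with semi w v w≢v
  ...   | inj₁ w⟶v = w , v , w⟶v , v∉H ∘ proj₂ ∘ Subdigraph.endpoints H
  ...   | inj₂ v⟶w = v , w , v⟶w , v∉H ∘ proj₁ ∘ Subdigraph.endpoints H
  missingArc semi ¬dicolourable H (inj₁ (v , v∉H)) | no single =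
    contradiction ((λ _ → zero) , λ c C → ⟶⇒≢ D (DirectedCycle.close C)
      (trans (only _) (sym (only _)))) ¬dicolourable
    where
    only : ∀ w → w ≡ v
    only w with w Fin.≟ v
    ... | yes w≡v = w≡v
    ... | no w≢v  = contradiction (w , w≢v) single

  arcCritical⇒threeDicritical : ArcCritical → ThreeDicritical D × SemiComplete D
  arcCritical⇒threeDicritical (semi , ¬dicolourable , deletable) = (¬dicolourable , proper) , semi
    where
    proper : (H : Subdigraph D) → Subdigraph.Proper H → Dicolourable 2 (Subdigraph.digraph H)
    proper H H-proper with missingArc semi ¬dicolourable H H-proper
    ... | u , v , u⟶v , uv∉H =
      dicolourable-pullback {E = deleteArc u v} proj₁ members-≡
        (λ p⟶q → fromWitness (Subdigraph.arc⊆ H p⟶q , λ { refl refl → uv∉H p⟶q }))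
        (deletable u v u⟶v)

-- Needed because decoding the code of a digraph restores its arcs only pointwise.
arcCritical-resp : {n : ℕ} {D E : Digraph (Fin n)} →
                   (∀ u v → Digraph.arc D u v ≡ Digraph.arc E u v) → ArcCritical D → ArcCritical E
arcCritical-resp {D = D} {E} D≗E (semi , ¬dicolourable , deletable) =
    semiᴱ
  , ¬dicolourable ∘ dicolourable-pullback {D = D} {E} id id (subst T (D≗E _ _))
  , λ u v u⟶v → dicolourable-pullback {D = deleteArc E u v} {deleteArc D u v} id id
      (λ p⟶q → let (arc , avoid) = toWitness p⟶q in
         fromWitness (subst T (sym (D≗E _ _)) arc , avoid))
      (deletable u v (subst T (sym (D≗E u v)) u⟶v))
  where
  semiᴱ : SemiComplete E
  semiᴱ u v u≢v with semi u v u≢v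
  ... | inj₁ u⟶v = inj₁ (subst T (D≗E u v) u⟶v)
  ... | inj₂ v⟶u = inj₂ (subst T (D≗E v u) v⟶u)

-- Decidability of criticality

-- The search runs over codes in a finite type. Decoding returns a function only up to `_≗_`, hence
-- the hypothesis that `P` respects it.
anyFunction? : {m n : ℕ} {P : (Fin m → Fin n) → Set} → (∀ {f g} → f ≗ g → P f → P g) →
               (∀ f → Dec (P f)) → Dec (∃[ f ] P f)
anyFunction? resp P? = map′ (λ (i , p) → finToFun i , p)
  (λ (f , p) → funToFin f , resp (sym ∘ Fin.finToFun-funToFin f) p)
  (Fin.any? (P? ∘ finToFun))

module _ {n : ℕ} (D : Digraph (Fin n)) where
  open Digraph D

  -- A directed cycle of `D [ P ]` with the membership proofs split off, so that the vertex map goes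
  -- between `Fin` types and can be searched for.
  IsCycleIn : (P : Fin n → Bool) (m : ℕ) → (Fin (suc m) → Fin n) → Set
  IsCycleIn P m f = (∀ i → T (P (f i))) × (∀ i j → f i ≡ f j → i ≡ j) ×
    (∀ i → f (inject₁ i) ⟶ f (suc i)) × f (fromℕ m) ⟶ f zero

  isCycleIn? : ∀ P m f → Dec (IsCycleIn P m f)
  isCycleIn? P m f =
    Fin.all? (λ i → T? (P (f i))) ×-dec
    Fin.all? (λ i → Fin.all? λ j → f i Fin.≟ f j →-dec i Fin.≟ j) ×-dec
    Fin.all? (λ i → T? (arc (f (inject₁ i)) (f (suc i)))) ×-dec
    T? (arc (f (fromℕ m)) (f zero))

  isCycleIn-resp : ∀ {P m f g} → f ≗ g → IsCycleIn P m f → IsCycleIn P m g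
  isCycleIn-resp {P} f≗g (mem , inj , step , close) =
      (λ i → subst (T ∘ P) (f≗g i) (mem i))
    , (λ i j gi≡gj → inj i j (trans (f≗g i) (trans gi≡gj (sym (f≗g j)))))
    , (λ i → subst₂ _⟶_ (f≗g _) (f≗g _) (step i))
    , subst₂ _⟶_ (f≗g _) (f≗g _) close

  -- A cycle has `suc m` distinct vertices among `n`, so only `m < n` has to be searched.
  acyclic? : ∀ P → Dec (Acyclic (D [ P ]))
  acyclic? P = ¬? (map′ toCycle fromCycle
    (anyUpTo? (λ m → anyFunction? (isCycleIn-resp {P}) (isCycleIn? P m)) n))
    where
    toCycle : (∃[ m ] (m < n × ∃[ f ] IsCycleIn P m f)) → DirectedCycle (D [ P ])
    toCycle (m , _ , f , mem , inj , step , close) = record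
      { m = m ; vertex = λ i → f i , mem i ; injective = λ eq → inj _ _ (cong proj₁ eq)
      ; step = step ; close = close }
    fromCycle : DirectedCycle (D [ P ]) → ∃[ m ] (m < n × ∃[ f ] IsCycleIn P m f)
    fromCycle C = m , Fin.injective⇒≤ (injective ∘ members-≡) , proj₁ ∘ vertex ,
      proj₂ ∘ vertex , (λ _ _ eq → injective (members-≡ eq)) , step , close
      where open DirectedCycle C

  dicolourable? : ∀ k → Dec (Dicolourable k D)
  dicolourable? k = anyFunction?
    (λ φ≗ψ φ-dicolouring c → acyclic-pullback {D = D} {D} id id
      (λ v∈c → fromWitness (trans (φ≗ψ _) (toWitness v∈c))) (λ _ _ → id) (φ-dicolouring c))
    (λ φ → Fin.all? λ c → acyclic? λ v → ⌊ φ v Fin.≟ c ⌋)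

arcCritical? : {n : ℕ} (D : Digraph (Fin n)) → Dec (ArcCritical D)
arcCritical? D =
  Fin.all? (λ u → Fin.all? λ v → ¬? (u Fin.≟ v) →-dec (T? (arc u v) ⊎-dec T? (arc v u))) ×-dec
  ¬? (dicolourable? D 2) ×-dec
  Fin.all? (λ u → Fin.all? λ v → T? (arc u v) →-dec dicolourable? (deleteArc D u v) 2)
  where open Digraph D

-- Enumeration up to isomorphism

-- Loops of the encoded relation are dropped, so that every code is valid.

decode : ∀ n → Fin (2 ^ (n * n)) → Digraph (Fin n)
decode n code = record
  { arc      = λ u v → ⌊ isArc? u v ⌋
  ; loopless = λ u u⟶u → proj₁ (toWitness u⟶u) refl
  }
  where
  isArc? : (u v : Fin n) → Dec (u ≢ v × finToFun code (combine u v) ≡ suc zero)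
  isArc? u v = ¬? (u Fin.≟ v) ×-dec (finToFun code (combine u v) Fin.≟ suc zero)

arcBit : ∀ {n} → Digraph (Fin n) → Fin n × Fin n → Fin 2
arcBit D (u , v) = if Digraph.arc D u v then suc zero else zero

encode : ∀ {n} → Digraph (Fin n) → Fin (2 ^ (n * n))
encode {n} D = funToFin (arcBit D ∘ remQuot {n} n)

encode-arcBit : ∀ {n} (D : Digraph (Fin n)) u v →
                finToFun (encode D) (combine u v) ≡ arcBit D (u , v)
encode-arcBit {n} D u v = trans (Fin.finToFun-funToFin (arcBit D ∘ remQuot {n} n) (combine u v))
                                (cong (arcBit D) (Fin.remQuot-combine u v))

decode-encode : ∀ {n} (D : Digraph (Fin n)) u v →
                Digraph.arc D u v ≡ Digraph.arc (decode _ (encode D)) u v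
decode-encode D u v
  rewrite encode-arcBit D u v with u Fin.≟ v | Digraph.arc D u v in eq
... | yes refl | true  = contradiction (subst T (sym eq) tt) (Digraph.loopless D u)
... | yes refl | false = refl
... | no _     | true  = refl
... | no _     | false = refl

open Setoid threeDicriticalSemiComplete using (Carrier; _≈_)

-- The decision is an argument so that membership can be proved by cases on an arbitrary one.
listIfCritical : ∀ {n} (D : Digraph (Fin n)) → Dec (ArcCritical D) → List Carrier
listIfCritical D (yes critical) = ((_ , D) , arcCritical⇒threeDicritical D critical) ∷ []
listIfCritical D (no _)         = []

criticalAt : ∀ n → Fin (2 ^ (n * n)) → List Carrier
criticalAt n code = listIfCritical (decode n code) (arcCritical? (decode n code))

-- Isomorphic digraphs may recur: an enumeration only has to meet every class.
criticalUpTo : ℕ → List Carrier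
criticalUpTo N = concatMap (λ n → concatMap (criticalAt n) (allFin _)) (upTo N)

∈-listIfCritical : ∀ {n} {D E : Digraph (Fin n)} critical →
                   (∀ u v → Digraph.arc D u v ≡ Digraph.arc E u v) →
                   (E? : Dec (ArcCritical E)) → Any (((n , D) , critical) ≈_) (listIfCritical E E?)
∈-listIfCritical critical D≗E (yes _) = here (record { bijection = ↔-id _ ; preserves = D≗E })
∈-listIfCritical {D = D} (critical , semi) D≗E (no ¬critical) = contradiction
  (arcCritical-resp D≗E (threeDicritical⇒arcCritical D critical semi)) ¬critical

∈-criticalUpTo : ∀ {N n} (D : Digraph (Fin n)) critical → n < N →
                 Any (((n , D) , critical) ≈_) (criticalUpTo N)
∈-criticalUpTo D critical n<N = Any.concatMap⁺ _
  (lose (∈-upTo⁺ n<N) (Any.concatMap⁺ _ (lose (∈-allFin (encode D))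
    (∈-listIfCritical critical (decode-encode D) (arcCritical? (decode _ (encode D)))))))

order<vertexBound : ∀ {n} (D : Digraph (Fin n)) → ThreeDicritical D → SemiComplete D →
                    n < vertexBound
order<vertexBound {n} D critical semi =
  subst (_< vertexBound) (length-tabulate id)
    (order-bounded Fin._≟_ D
      (arcCritical⇒locallyCritical D (threeDicritical⇒arcCritical D critical semi)) semi
      (Unique.allFin⁺ n))

theorem9 : ∃[ Ds ] IsEnumeration threeDicriticalSemiComplete Ds
theorem9 = criticalUpTo vertexBound , λ ((_ , D) , critical , semi) →
  ∈-criticalUpTo D (critical , semi) (order<vertexBound D critical semi)
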